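{- Suppose $\mathcal D=(\mathcal P,\mathcal B,\mathcal I)$ is a non-trivial $G$-pairwise transitive $2$-design, where $G\le\mathrm{Aut}(\mathcal D)$. Then $\mathcal D$ is connected, and the following properties hold: (a) $G^{\mathcal P}$ is $2$-transitive; (b) either $G^{\mathcal B}$ is $2$-transitive, or $G^{\mathcal B}$ is transitive of rank $3$ and $\mathcal D$ has non-intersecting blocks; (c) $G_p$ has two orbits on $\mathcal B$, for any $p\in\mathcal P$; (d) $G_b$ has two orbits on $\mathcal P$, for any $b\in\mathcal B$; (e) $\mathcal D$ has no repeated blocks; (f) if $p_1,p_2$ are distinct points, then $[p_1]\ne[p_2]$; (g) $G$ acts faithfully on $\mathcal P$; (h) $G$ acts faithfully on $\mathcal B$.
   Context: A design $\mathcal D=(\mathcal P,\mathcal B,\mathcal I)$ consists of finite sets $\mathcal P$ (points), $\mathcal B$ (blocks) and an incidence relation $\mathcal I\subseteq\mathcal P\times\mathcal B$. It is a $2$-$(v,k,\lambda)$ design (or $2$-design) if $|\mathcal P|=v$, each block is incident with exactly $k$ points, and each pair of distinct points is incident with exactly $\lambda$ common blocks. It is non-trivial if $2<k<v$. For a point $p$, $[p]$ is the set of blocks incident with $p$; for a block $b$, $[b]$ is the set of points incident with $b$. A block $b$ is repeated if $[b]=[b']$ for some block $b'\ne b$. The design is connected if its incidence graph (vertex set $\mathcal P\cup\mathcal B$, edges the incident point-block pairs) is connected. An automorphism is a permutation of $\mathcal P\cup\mathcal B$ leaving $\mathcal P$ and $\mathcal B$ invariant setwise and preserving incidence; $\mathrm{Aut}(\mathcal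 D)$ is the group of all automorphisms. Two blocks are intersecting if some point is incident with both. For $G\le\mathrm{Aut}(\mathcal D)$, the $2$-design $\mathcal D$ is $G$-pairwise transitive if $G$ is transitive on each of the following five (possibly empty) sets of ordered pairs: pairs of distinct points, incident point-block pairs, non-incident point-block pairs, pairs of distinct intersecting blocks, pairs of non-intersecting blocks. $G^{\mathcal P}$ and $G^{\mathcal B}$ are the permutation groups induced by $G$ on $\mathcal P$ and $\mathcal B$; $G_x$ is the stabiliser of $x$. A transitive permutation group has rank $n$ if a point stabiliser has exactly $n$ orbits. -}

module Defs where

open import Data.Fin.Base using (Fin)
open import Data.Nat.Base using (ℕ; _<_)
open import Data.Product.Base using (∃-syntax; _×_; _,_; proj₁)
open import Data.Sum.Base using (_⊎_; inj₁; inj₂)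
open import Function.Base using (id)
open import Function.Bundles using (_↔_; _⇔_; Inverse)
open import Function.Construct.Composition using (_↔-∘_; _⇔-∘_)
open import Function.Construct.Identity using (↔-id; ⇔-id)
open import Function.Construct.Symmetry using (↔-sym; ⇔-sym)
open import Level using (0ℓ)
open import Relation.Binary.Bundles using (Setoid)
open import Relation.Binary.Construct.Closure.Equivalence using (EqClosure)
import Relation.Binary.Construct.On as On
open import Relation.Binary.Core using (Rel; REL)
open import Relation.Binary.PropositionalEquality
  using (_≡_; _≢_; _≗_; refl; sym; trans; cong)
import Relation.Binary.PropositionalEquality.Properties as ≡
open import Relation.Nullary using (¬_)
open import Relation.Unary using (Pred; _≐_)

------------------------------------------------------------------------
-- Cardinality

-- The setoid S has exactly n equivalence classes.
_HasSize_ : Setoid 0ℓ 0ℓ → ℕ → Set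
S HasSize n = Inverse S (≡.setoid (Fin n))

⌞_⌟ : Set → Setoid 0ℓ 0ℓ
⌞ A ⌟ = ≡.setoid A

-- Elements are compared by their first components only, so that the
-- proofs of membership do not contribute to the size of a subset.
⟪_⟫ : {A : Set} → Pred A 0ℓ → Setoid 0ℓ 0ℓ
⟪_⟫ {A} P = On.setoid (≡.setoid A) (proj₁ {B = P})

------------------------------------------------------------------------
-- Permutation groups

_·_ : {Ω : Set} → Ω ↔ Ω → Ω → Ω
π · x = Inverse.to π x

infixr 9 _·_

undo : {Ω : Set} (π : Ω ↔ Ω) {x y : Ω} → π · x ≡ y → ↔-sym π · y ≡ x
undo π refl = Inverse.strictlyInverseʳ π _

redo : {Ω : Set} (π : Ω ↔ Ω) {x y : Ω} → ↔-sym π · y ≡ x → π · x ≡ y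
redo π refl = Inverse.strictlyInverseˡ π _

-- A subgroup of Sym(Ω).  An element of Ω ↔ Ω carries proof components
-- besides the underlying map; respects-≗ makes membership depend on the
-- map alone.
record PermutationGroup (Ω : Set) : Set₁ where
  field
    Member     : Pred (Ω ↔ Ω) 0ℓ
    respects-≗ : ∀ {π σ} → Inverse.to π ≗ Inverse.to σ → Member π → Member σ
    id-closed  : Member (↔-id Ω)
    ∘-closed   : ∀ {π σ} → Member π → Member σ → Member (π ↔-∘ σ)
    ⁻¹-closed  : ∀ {π} → Member π → Member (↔-sym π)

open PermutationGroup public

_∈ᴳ_ : {Ω : Set} → Ω ↔ Ω → PermutationGroup Ω → Set
π ∈ᴳ G = Member G π

_≤ᴳ_ : {Ω : Set} → PermutationGroup Ω → PermutationGroup Ω → Set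
H ≤ᴳ G = ∀ {π} → π ∈ᴳ H → π ∈ᴳ G

infix 4 _∈ᴳ_ _≤ᴳ_

Stabiliser : {Ω : Set} → PermutationGroup Ω → Ω → PermutationGroup Ω
Stabiliser G x = record
  { Member     = λ π → π ∈ᴳ G × π · x ≡ x
  ; respects-≗ = λ π≗σ (π∈G , πx) → respects-≗ G π≗σ π∈G , trans (sym (π≗σ x)) πx
  ; id-closed  = id-closed G , refl
  ; ∘-closed   = λ {π} (π∈G , πx) (σ∈G , σx) →
      ∘-closed G π∈G σ∈G , trans (cong (π ·_) σx) πx
  ; ⁻¹-closed  = λ {π} (π∈G , πx) → ⁻¹-closed G π∈G , undo π πx
  }

-- The permutation group induced on A by its embedding f : A → Ω.
-- Intended for injective f with G-invariant image.
Induced : {Ω A : Set} → PermutationGroup Ω → (A → Ω) → PermutationGroup A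
Induced G f = record
  { Member     = λ σ → ∃[ π ] π ∈ᴳ G × (∀ a → π · f a ≡ f (σ · a))
  ; respects-≗ = λ σ≗τ (π , π∈G , eq) →
      π , π∈G , λ a → trans (eq a) (cong f (σ≗τ a))
  ; id-closed  = ↔-id _ , id-closed G , λ _ → refl
  ; ∘-closed   = λ {_} {τ} (π , π∈G , eq) (ρ , ρ∈G , eq′) →
      π ↔-∘ ρ , ∘-closed G π∈G ρ∈G ,
      λ a → trans (cong (π ·_) (eq′ a)) (eq (τ · a))
  ; ⁻¹-closed  = λ {σ} (π , π∈G , eq) →
      ↔-sym π , ⁻¹-closed G π∈G ,
      λ a → undo π (trans (eq (↔-sym σ · a)) (cong f (Inverse.strictlyInverseˡ σ a)))
  }

-- The elements of A modulo the orbits of G, where A is regarded as a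
-- subset of Ω through f.
Orbits : {Ω A : Set} → PermutationGroup Ω → (A → Ω) → Setoid 0ℓ 0ℓ
Orbits {A = A} G f = record
  { Carrier       = A
  ; _≈_           = λ a b → ∃[ π ] π ∈ᴳ G × π · f a ≡ f b
  ; isEquivalence = record
    { refl  = ↔-id _ , id-closed G , refl
    ; sym   = λ (π , π∈G , eq) → ↔-sym π , ⁻¹-closed G π∈G , undo π eq
    ; trans = λ (π , π∈G , eq) (ρ , ρ∈G , eq′) →
        ρ ↔-∘ π , ∘-closed G ρ∈G π∈G , trans (cong (ρ ·_) eq) eq′
    }
  }

Transitive : {Ω : Set} → PermutationGroup Ω → Set
Transitive G = ∀ x y → ∃[ π ] π ∈ᴳ G × π · x ≡ y

-- Transitivity on the set of pairs (f a , h b) with R a b; this holds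
-- vacuously if there are no such pairs.
TransitiveOnPairs : {Ω A B : Set} → PermutationGroup Ω →
                    (A → Ω) → (B → Ω) → REL A B 0ℓ → Set
TransitiveOnPairs G f h R = ∀ {a b a′ b′} → R a b → R a′ b′ →
  ∃[ π ] π ∈ᴳ G × π · f a ≡ f a′ × π · h b ≡ h b′

TwoTransitive : {Ω : Set} → PermutationGroup Ω → Set
TwoTransitive G = TransitiveOnPairs G id id _≢_

TransitiveOfRank : {Ω : Set} → ℕ → PermutationGroup Ω → Set
TransitiveOfRank n G = Transitive G × (∀ x → Orbits (Stabiliser G x) id HasSize n)

------------------------------------------------------------------------
-- Designs

record Design : Set₁ where
  field
    Point        : Set
    Block        : Set
    _I_          : REL Point Block 0ℓ
    pointsFinite : ∃[ n ] ⌞ Point ⌟ HasSize n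
    blocksFinite : ∃[ n ] ⌞ Block ⌟ HasSize n

  infix 4 _I_

  Vertex : Set
  Vertex = Point ⊎ Block

  blocksOn : Point → Pred Block 0ℓ
  blocksOn p b = p I b

  pointsOn : Block → Pred Point 0ℓ
  pointsOn b p = p I b

  Repeated : Pred Block 0ℓ
  Repeated b = ∃[ b′ ] b′ ≢ b × pointsOn b ≐ pointsOn b′

  Intersecting : Rel Block 0ℓ
  Intersecting b b′ = ∃[ p ] p I b × p I b′

  -- Each edge of the incidence graph, oriented from point to block.
  data Edge : Rel Vertex 0ℓ where
    edge : ∀ {p b} → p I b → Edge (inj₁ p) (inj₂ b)

  Connected : Set
  Connected = ∀ x y → EqClosure Edge x y

  record IsAutomorphism (π : Vertex ↔ Vertex) : Set where
    field
      points    : ∀ p → ∃[ p′ ] π · inj₁ p ≡ inj₁ p′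
      blocks    : ∀ b → ∃[ b′ ] π · inj₂ b ≡ inj₂ b′
      incidence : ∀ {p b p′ b′} → π · inj₁ p ≡ inj₁ p′ → π · inj₂ b ≡ inj₂ b′ →
                  p I b ⇔ p′ I b′

  open IsAutomorphism

  private
    inj₁≢inj₂ : {p : Point} {b : Block} {A : Set} →
                _≡_ {A = Vertex} (inj₁ p) (inj₂ b) → A
    inj₁≢inj₂ ()

    points⁻¹ : ∀ {π} → IsAutomorphism π → ∀ p → ∃[ p′ ] ↔-sym π · inj₁ p ≡ inj₁ p′
    points⁻¹ {π} α p with ↔-sym π · inj₁ p in eq
    ... | inj₁ p′ = p′ , refl
    ... | inj₂ b with b′ , eq′ ← blocks α b =
      inj₁≢inj₂ (trans (sym (redo π eq)) eq′)

    blocks⁻¹ : ∀ {π} → IsAutomorphism π → ∀ b → ∃[ b′ ] ↔-sym π · inj₂ b ≡ inj₂ b′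
    blocks⁻¹ {π} α b with ↔-sym π · inj₂ b in eq
    ... | inj₂ b′ = b′ , refl
    ... | inj₁ p with p′ , eq′ ← points α p =
      inj₁≢inj₂ (trans (sym eq′) (redo π eq))

  Aut : PermutationGroup Vertex
  Aut = record
    { Member     = IsAutomorphism
    ; respects-≗ = λ π≗σ α → record
      { points    = λ p → let p′ , eq = points α p in p′ , trans (sym (π≗σ _)) eq
      ; blocks    = λ b → let b′ , eq = blocks α b in b′ , trans (sym (π≗σ _)) eq
      ; incidence = λ eq eq′ → incidence α (trans (π≗σ _) eq) (trans (π≗σ _) eq′)
      }
    ; id-closed  = record
      { points    = λ p → p , refl
      ; blocks    = λ b → b , refl
      ; incidence = λ { refl refl → ⇔-id _ }
      }
    ; ∘-closed   = λ {π} {σ} α β → record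
      { points    = λ p → let p′ , eq = points β p ; p″ , eq′ = points α p′ in
                          p″ , trans (cong (π ·_) eq) eq′
      ; blocks    = λ b → let b′ , eq = blocks β b ; b″ , eq′ = blocks α b′ in
                          b″ , trans (cong (π ·_) eq) eq′
      ; incidence = λ {p} {b} eq eq′ →
          let p₁ , eq₁ = points β p ; b₁ , eq₂ = blocks β b in
          incidence α (trans (sym (cong (π ·_) eq₁)) eq)
                      (trans (sym (cong (π ·_) eq₂)) eq′)
          ⇔-∘ incidence β eq₁ eq₂
      }
    ; ⁻¹-closed  = λ {π} α → record
      { points    = points⁻¹ α
      ; blocks    = blocks⁻¹ α
      ; incidence = λ eq eq′ → ⇔-sym (incidence α (redo π eq) (redo π eq′))
      }
    }

  -- The requirement 0 < l is the usual convention that the parameters of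
  -- a 2-design are positive.  For 2 ≤ k ≤ v it says that there is at
  -- least one block.
  record Is2Design (v k l : ℕ) : Set where
    field
      v-points     : ⌞ Point ⌟ HasSize v
      block-size   : ∀ b → ⟪ pointsOn b ⟫ HasSize k
      pair-count   : ∀ {p q} → p ≢ q → ⟪ (λ b → p I b × q I b) ⟫ HasSize l
      positive-l   : 0 < l

  -- G^P and G^B
  onPoints : PermutationGroup Vertex → PermutationGroup Point
  onPoints G = Induced G inj₁

  onBlocks : PermutationGroup Vertex → PermutationGroup Block
  onBlocks G = Induced G inj₂

  record PairwiseTransitive (G : PermutationGroup Vertex) : Set where
    field
      distinct-points     : TransitiveOnPairs G inj₁ inj₁ _≢_
      incident-pairs      : TransitiveOnPairs G inj₁ inj₂ _I_
      non-incident-pairs  : TransitiveOnPairs G inj₁ inj₂ (λ p b → ¬ p I b)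
      intersecting-blocks : TransitiveOnPairs G inj₂ inj₂
                              (λ b b′ → b ≢ b′ × Intersecting b b′)
      non-intersecting    : TransitiveOnPairs G inj₂ inj₂
                              (λ b b′ → ¬ Intersecting b b′)

  FaithfulOn : {A : Set} → PermutationGroup Vertex → (A → Vertex) → Set
  FaithfulOn G f = ∀ {π} → π ∈ᴳ G → (∀ a → π · f a ≡ f a) → ∀ x → π · x ≡ x

NonTrivial : (v k : ℕ) → Set
NonTrivial v k = 2 < k × k < v

{-# OPTIONS --safe #-}
-- Choose an incident pair p I b and a point q off b (there is one since k < v),
-- and a block c through p and q.  Then c ≠ b meets b in p, and the set-up is
-- asymmetric: q lies on c but not on b, and b contains p but not q.  As G is
-- transitive on distinct intersecting blocks and on distinct points, no two
-- such blocks have the same points and no two points lie on the same blocks;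
-- faithfulness follows.  The orbits of a stabiliser are exactly the classes on
-- which the pairwise transitivity hypotheses apply, so only their
-- non-emptiness has to be checked.
module Submission where

open import Defs
open import Data.Empty using (⊥-elim)
open import Data.Fin.Base using (Fin; zero; suc; fromℕ<)
open import Data.Fin.Properties using (any?; injective⇒≤; 0≢1+n) renaming (_≟_ to _≟ᶠ_)
open import Data.Nat.Base using (ℕ; _<_; z<s; s<s)
open import Data.Nat.Properties using (<⇒≱; <-trans)
open import Data.Product.Base using (∃-syntax; _×_; _,_; proj₁; proj₂)
open import Data.Sum.Base using (_⊎_; inj₁; inj₂)
open import Data.Sum.Properties using (inj₁-injective; inj₂-injective)
open import Function.Base using (id; _∘_)
open import Function.Bundles using (_↔_; Inverse; Equivalence; Injection; mk↔ₛ′)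
open import Function.Construct.Symmetry using (↔-sym)
open import Function.Definitions using (Injective)
open import Function.Properties.Inverse using (Inverse⇒Injection)
open import Level using (0ℓ)
open import Relation.Binary.Bundles using (Setoid)
open import Relation.Binary.Construct.Closure.Equivalence using (EqClosure; return)
import Relation.Binary.Construct.Closure.Equivalence as EqClosure
open import Relation.Binary.Core using (Rel)
open import Relation.Binary.Definitions using (DecidableEquality)
open import Relation.Binary.PropositionalEquality
  using (_≡_; _≢_; refl; sym; trans; cong; subst; ≢-sym)
open import Relation.Nullary using (¬_; Dec; yes; no)
open import Relation.Nullary.Decidable using (map′; ¬?; decidable-stable; via-injection; _×-dec_)
open import Relation.Unary using (Pred; Decidable; _≐_)

module _ {A : Set} {n : ℕ} (size : ⌞ A ⌟ HasSize n) where

  open Inverse size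

  from-injective : Injective _≡_ _≡_ from
  from-injective = Injection.injective (Inverse⇒Injection (↔-sym size))

  finite⇒≟ : DecidableEquality A
  finite⇒≟ = via-injection (Inverse⇒Injection size) _≟ᶠ_

  finite⇒∃? : {P : Pred A 0ℓ} → Decidable P → Dec (∃[ a ] P a)
  finite⇒∃? {P} P? = map′
    (λ (i , Pi) → from i , Pi)
    (λ (a , Pa) → to a , subst P (sym (strictlyInverseʳ a)) Pa)
    (any? (P? ∘ from))

  size>1⇒other : 1 < n → (a : A) → ∃[ a′ ] a ≢ a′
  size>1⇒other (s<s z<s) a with finite⇒≟ a (from zero)
  ... | no a≢0   = from zero , a≢0
  ... | yes a≡0  = from (suc zero) , λ eq → 0≢1+n (from-injective (trans (sym a≡0) eq))

module _ {A : Set} {P : Pred A 0ℓ} {k : ℕ} (size : ⟪ P ⟫ HasSize k) where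

  open Inverse size

  size>0⇒inhabited : 0 < k → ∃[ a ] P a
  size>0⇒inhabited 0<k = from (fromℕ< 0<k)

  finite⇒∈? : DecidableEquality A → Decidable P
  finite⇒∈? _≟_ a = map′
    (λ (i , eq) → subst P eq (proj₂ (from i)))
    (λ Pa → to (a , Pa) , strictlyInverseʳ (a , Pa))
    (any? λ i → proj₁ (from i) ≟ a)

  smaller⇒∃∉ : ∀ {n} → ⌞ A ⌟ HasSize n → k < n → ∃[ a ] ¬ P a
  smaller⇒∃∉ {n} sizeA k<n with finite⇒∃? sizeA (¬? ∘ finite⇒∈? (finite⇒≟ sizeA))
  ... | yes ∃∉ = ∃∉
  ... | no ∄∉ = ⊥-elim (<⇒≱ k<n (injective⇒≤ {f = index} index-injective))
    where
    module A = Inverse sizeA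

    all : ∀ a → P a
    all a = decidable-stable (finite⇒∈? (finite⇒≟ sizeA) a) (λ ¬Pa → ∄∉ (a , ¬Pa))

    index : Fin n → Fin k
    index i = to (A.from i , all (A.from i))

    index-injective : Injective _≡_ _≡_ index
    index-injective eq =
      from-injective sizeA (Injection.injective (Inverse⇒Injection size) eq)

classes⇒HasSize : (S : Setoid 0ℓ 0ℓ) (let open Setoid S using (Carrier; _≈_)) {n : ℕ} (C : Fin n → Pred Carrier 0ℓ) →
  (∀ a → ∃[ i ] C i a) →
  (∀ {i j a} → C i a → C j a → i ≡ j) →
  (∀ i {a b} → a ≈ b → C i a → C i b) →
  (∀ i {a b} → C i a → C i b → a ≈ b) →
  (∀ i → ∃[ a ] C i a) →
  S HasSize n
classes⇒HasSize S C classify unique resp related inhabited = record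
  { to        = λ a → proj₁ (classify a)
  ; from      = λ i → proj₁ (inhabited i)
  ; to-cong   = λ {a} {b} a≈b → unique (resp _ a≈b (proj₂ (classify a))) (proj₂ (classify b))
  ; from-cong = λ { refl → Setoid.refl S }
  ; inverse   =
      (λ {i} {a} a≈ → unique (proj₂ (classify a)) (resp _ (Setoid.sym S a≈) (proj₂ (inhabited i))))
    , (λ { {a} refl → related _ (proj₂ (inhabited _)) (proj₂ (classify a)) })
  }

dichotomy⇒HasSize2 : (S : Setoid 0ℓ 0ℓ) (let open Setoid S using (Carrier; _≈_)) {P : Pred Carrier 0ℓ} → Decidable P →
  (∀ {a b} → a ≈ b → P a → P b) →
  (∀ {a b} → P a → P b → a ≈ b) →
  (∀ {a b} → ¬ P a → ¬ P b → a ≈ b) →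
  ∃[ a ] P a → ∃[ a ] ¬ P a →
  S HasSize 2
dichotomy⇒HasSize2 S {P} P? resp inside outside ∃∈ ∃∉ =
  classes⇒HasSize S C classify unique respC related λ { zero → ∃∈ ; (suc zero) → ∃∉ }
  where
  open Setoid S using (Carrier; _≈_)

  C : Fin 2 → Pred Carrier 0ℓ
  C zero       a = P a
  C (suc zero) a = ¬ P a

  classify : ∀ a → ∃[ i ] C i a
  classify a with P? a
  ... | yes Pa = zero , Pa
  ... | no ¬Pa = suc zero , ¬Pa

  unique : ∀ {i j a} → C i a → C j a → i ≡ j
  unique {zero}     {zero}     _   _   = refl
  unique {zero}     {suc zero} Pa  ¬Pa = ⊥-elim (¬Pa Pa)
  unique {suc zero} {zero}     ¬Pa Pa  = ⊥-elim (¬Pa Pa)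
  unique {suc zero} {suc zero} _   _   = refl

  respC : ∀ i {a b} → a ≈ b → C i a → C i b
  respC zero       a≈b Pa     = resp a≈b Pa
  respC (suc zero) a≈b ¬Pa Pb = ¬Pa (resp (Setoid.sym S a≈b) Pb)

  related : ∀ i {a b} → C i a → C i b → a ≈ b
  related zero       = inside
  related (suc zero) = outside

module _ {Ω A : Set} (G : PermutationGroup Ω) (f : A → Ω) (f-injective : Injective _≡_ _≡_ f)
         (invariant : ∀ {π} → π ∈ᴳ G → ∀ a → ∃[ a′ ] π · f a ≡ f a′) where

  restrict : ∀ {π} → π ∈ᴳ G → A ↔ A
  restrict {π} π∈G = mk↔ₛ′ (proj₁ ∘ invariant π∈G) (proj₁ ∘ invariant (⁻¹-closed G π∈G))
    (λ a → let a′ , eq = invariant (⁻¹-closed G π∈G) a ; _ , eq′ = invariant π∈G a′ in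
           f-injective (trans (sym eq′) (redo π eq)))
    (λ a → let a′ , eq = invariant π∈G a ; _ , eq′ = invariant (⁻¹-closed G π∈G) a′ in
           f-injective (trans (sym eq′) (undo π eq)))

  restrict∈Induced : ∀ {π} (π∈G : π ∈ᴳ G) → restrict π∈G ∈ᴳ Induced G f
  restrict∈Induced {π} π∈G = π , π∈G , proj₂ ∘ invariant π∈G

  restrict-· : ∀ {π} (π∈G : π ∈ᴳ G) {a a′} → π · f a ≡ f a′ → restrict π∈G · a ≡ a′
  restrict-· π∈G {a} eq = f-injective (trans (sym (proj₂ (invariant π∈G a))) eq)

  transitiveOnPairs-Induced : ∀ {R : Rel A 0ℓ} →
    TransitiveOnPairs G f f R → TransitiveOnPairs (Induced G f) id id R
  transitiveOnPairs-Induced trans₂ Rab Ra′b′ =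
    let _ , π∈G , eq , eq′ = trans₂ Rab Ra′b′ in
    restrict π∈G , restrict∈Induced π∈G , restrict-· π∈G eq , restrict-· π∈G eq′

module PairwiseTransitiveDesign
  (D : Design) (v k l : ℕ)
  (is2Design : Design.Is2Design D v k l) (nonTrivial : NonTrivial v k)
  (G : PermutationGroup (Design.Vertex D)) (G≤Aut : G ≤ᴳ Design.Aut D)
  (pairwiseTransitive : Design.PairwiseTransitive D G) where

  open Design D
  open Is2Design is2Design
  open PairwiseTransitive pairwiseTransitive

  blocks-finite : ⌞ Block ⌟ HasSize (proj₁ blocksFinite)
  blocks-finite = proj₂ blocksFinite

  _≟ᴾ_ : DecidableEquality Point
  _≟ᴾ_ = finite⇒≟ v-points

  _≟ᴮ_ : DecidableEquality Block
  _≟ᴮ_ = finite⇒≟ blocks-finite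

  _I?_ : ∀ p b → Dec (p I b)
  p I? b = finite⇒∈? (block-size b) _≟ᴾ_ p

  intersecting? : ∀ b b′ → Dec (Intersecting b b′)
  intersecting? b b′ = finite⇒∃? v-points λ p → (p I? b) ×-dec (p I? b′)

  0<k : 0 < k
  0<k = <-trans z<s (proj₁ nonTrivial)

  1<v : 1 < v
  1<v = <-trans (<-trans (s<s z<s) (proj₁ nonTrivial)) (proj₂ nonTrivial)

  pointOn : ∀ b → ∃[ p ] p I b
  pointOn b = size>0⇒inhabited (block-size b) 0<k

  pointOff : ∀ b → ∃[ q ] ¬ q I b
  pointOff b = smaller⇒∃∉ (block-size b) v-points (proj₂ nonTrivial)

  blockJoining : ∀ {p q} → p ≢ q → ∃[ b ] p I b × q I b
  blockJoining p≢q = size>0⇒inhabited (pair-count p≢q) positive-l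

  blockOn : ∀ p → ∃[ b ] p I b
  blockOn p = let _ , p≢q = size>1⇒other v-points 1<v p ; b , pIb , _ = blockJoining p≢q in b , pIb

  I∧¬I⇒≢ᴾ : ∀ {p q b} → p I b → ¬ q I b → p ≢ q
  I∧¬I⇒≢ᴾ pIb ¬qIb refl = ¬qIb pIb

  ¬I∧I⇒≢ᴮ : ∀ {q b c} → ¬ q I b → q I c → b ≢ c
  ¬I∧I⇒≢ᴮ ¬qIb qIc refl = ¬qIb qIc

  crossingBlock : ∀ b → ∃[ c ] b ≢ c × Intersecting b c × ∃[ q ] q I c × ¬ q I b
  crossingBlock b =
    let p , pIb = pointOn b ; q , ¬qIb = pointOff b
        c , pIc , qIc = blockJoining (I∧¬I⇒≢ᴾ pIb ¬qIb)
    in c , ¬I∧I⇒≢ᴮ ¬qIb qIc , (p , pIb , pIc) , q , qIc , ¬qIb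

  ¬intersecting⇒≢ : ∀ {b b′} → ¬ Intersecting b b′ → b ≢ b′
  ¬intersecting⇒≢ {b} ¬int refl = let p , pIb = pointOn b in ¬int (p , pIb , pIb)

  invariantᴾ : ∀ {π} → π ∈ᴳ G → ∀ p → ∃[ p′ ] π · inj₁ p ≡ inj₁ p′
  invariantᴾ π∈G = IsAutomorphism.points (G≤Aut π∈G)

  invariantᴮ : ∀ {π} → π ∈ᴳ G → ∀ b → ∃[ b′ ] π · inj₂ b ≡ inj₂ b′
  invariantᴮ π∈G = IsAutomorphism.blocks (G≤Aut π∈G)

  module _ {π : Vertex ↔ Vertex} (π∈G : π ∈ᴳ G)
           {p p′ b b′} (πp : π · inj₁ p ≡ inj₁ p′) (πb : π · inj₂ b ≡ inj₂ b′) where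

    I⁺ : p I b → p′ I b′
    I⁺ = Equivalence.to (IsAutomorphism.incidence (G≤Aut π∈G) πp πb)

    I⁻ : p′ I b′ → p I b
    I⁻ = Equivalence.from (IsAutomorphism.incidence (G≤Aut π∈G) πp πb)

  intersecting⁺ : ∀ {π} → π ∈ᴳ G → ∀ {b b′ c c′} → π · inj₂ b ≡ inj₂ b′ → π · inj₂ c ≡ inj₂ c′ →
    Intersecting b c → Intersecting b′ c′
  intersecting⁺ π∈G πb πc (p , pIb , pIc) =
    let p′ , πp = invariantᴾ π∈G p in p′ , I⁺ π∈G πp πb pIb , I⁺ π∈G πp πc pIc

  blockOff : ∀ p → ∃[ b ] ¬ p I b
  blockOff p =
    let b , pIb = blockOn p ; q , ¬qIb = pointOff b
        p≢q = I∧¬I⇒≢ᴾ pIb ¬qIb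
        _ , π∈G , πq , _ = distinct-points (≢-sym p≢q) p≢q
        b′ , πb = invariantᴮ π∈G b
    in b′ , ¬qIb ∘ I⁻ π∈G πq πb

  connected : Connected
  connected x y =
    let p , x~p = toPoint x ; q , y~q = toPoint y in
    EqClosure.transitive Edge x~p
      (EqClosure.transitive Edge (pointToPoint p q) (EqClosure.symmetric Edge y~q))
    where
    toPoint : ∀ x → ∃[ p ] EqClosure Edge x (inj₁ p)
    toPoint (inj₁ p) = p , EqClosure.reflexive Edge
    toPoint (inj₂ b) = let p , pIb = pointOn b in
      p , EqClosure.symmetric Edge (return (edge pIb))

    pointToPoint : ∀ p q → EqClosure Edge (inj₁ p) (inj₁ q)
    pointToPoint p q with p ≟ᴾ q
    ... | yes refl = EqClosure.reflexive Edge
    ... | no p≢q   = let _ , pIb , qIb = blockJoining p≢q in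
      EqClosure.transitive Edge (return (edge pIb)) (EqClosure.symmetric Edge (return (edge qIb)))

  twoTransitiveᴾ : TwoTransitive (onPoints G)
  twoTransitiveᴾ = transitiveOnPairs-Induced G inj₁ inj₁-injective invariantᴾ distinct-points

  transitiveᴮ : ∀ b b′ → ∃[ π ] π ∈ᴳ G × π · inj₂ b ≡ inj₂ b′
  transitiveᴮ b b′ =
    let _ , pIb = pointOn b ; _ , p′Ib′ = pointOn b′
        π , π∈G , _ , πb = incident-pairs pIb p′Ib′
    in π , π∈G , πb

  module _ {c c′} (¬int : ¬ Intersecting c c′) where

    disjointBlock : ∀ b → ∃[ d ] ¬ Intersecting b d
    disjointBlock b =
      let π , π∈G , πc = transitiveᴮ c b ; d , πc′ = invariantᴮ π∈G c′
      in d , λ int → ¬int (intersecting⁺ (⁻¹-closed G π∈G) (undo π πc) (undo π πc′) int)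

    rank3 : TransitiveOfRank 3 (onBlocks G)
    rank3 =
        (λ b b′ → let _ , π∈G , πb = transitiveᴮ b b′ in lift π∈G , lift∈ π∈G , lift-· π∈G πb)
      , (λ b → classes⇒HasSize (suborbits b) (C b) (classify b) (unique b) (resp b) (related b) (inhabited b))
      where
      lift   = restrict G inj₂ inj₂-injective invariantᴮ
      lift∈  = restrict∈Induced G inj₂ inj₂-injective invariantᴮ
      lift-· : ∀ {π} (π∈G : π ∈ᴳ G) {a a′} → π · inj₂ a ≡ inj₂ a′ → lift π∈G · a ≡ a′
      lift-· = restrict-· G inj₂ inj₂-injective invariantᴮ

      suborbits : Block → Setoid 0ℓ 0ℓ
      suborbits b = Orbits (Stabiliser (onBlocks G) b) id

      C : Block → Fin 3 → Pred Block 0ℓ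
      C b zero             d = b ≡ d
      C b (suc zero)       d = b ≢ d × Intersecting b d
      C b (suc (suc zero)) d = ¬ Intersecting b d

      classify : ∀ b d → ∃[ i ] C b i d
      classify b d with b ≟ᴮ d | intersecting? b d
      ... | yes b≡d | _        = zero , b≡d
      ... | no b≢d  | yes int  = suc zero , b≢d , int
      ... | no _    | no ¬int′ = suc (suc zero) , ¬int′

      unique : ∀ b {i j d} → C b i d → C b j d → i ≡ j
      unique b {zero}           {zero}           _         _         = refl
      unique b {zero}           {suc zero}       b≡d       (b≢d , _) = ⊥-elim (b≢d b≡d)
      unique b {zero}           {suc (suc zero)} b≡d       ¬i        = ⊥-elim (¬intersecting⇒≢ ¬i b≡d)
      unique b {suc zero}       {zero}           (b≢d , _) b≡d       = ⊥-elim (b≢d b≡d)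
      unique b {suc zero}       {suc zero}       _         _         = refl
      unique b {suc zero}       {suc (suc zero)} (_ , i)   ¬i        = ⊥-elim (¬i i)
      unique b {suc (suc zero)} {zero}           ¬i        b≡d       = ⊥-elim (¬intersecting⇒≢ ¬i b≡d)
      unique b {suc (suc zero)} {suc zero}       ¬i        (_ , i)   = ⊥-elim (¬i i)
      unique b {suc (suc zero)} {suc (suc zero)} _         _         = refl

      resp-≡ : ∀ b {d e} → Setoid._≈_ (suborbits b) d e → b ≡ d → b ≡ e
      resp-≡ b (_ , (_ , σb) , σd) refl = trans (sym σb) σd

      resp-intersecting : ∀ b {d e} → Setoid._≈_ (suborbits b) d e →
        Intersecting b d → Intersecting b e
      resp-intersecting b (σ , ((π , π∈G , πσ) , σb) , σd) =
        intersecting⁺ π∈G (trans (πσ _) (cong inj₂ σb)) (trans (πσ _) (cong inj₂ σd))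

      resp : ∀ b i {d e} → Setoid._≈_ (suborbits b) d e → C b i d → C b i e
      resp b zero             d≈e b≡d         = resp-≡ b d≈e b≡d
      resp b (suc zero)       d≈e (b≢d , int) =
        b≢d ∘ resp-≡ b (Setoid.sym (suborbits b) d≈e) , resp-intersecting b d≈e int
      resp b (suc (suc zero)) d≈e ¬i          =
        ¬i ∘ resp-intersecting b (Setoid.sym (suborbits b) d≈e)

      related : ∀ b i {d e} → C b i d → C b i e → Setoid._≈_ (suborbits b) d e
      related b zero refl refl = Setoid.refl (suborbits b)
      related b (suc zero) Cd Ce =
        let _ , π∈G , πb , πd = intersecting-blocks Cd Ce
        in lift π∈G , (lift∈ π∈G , lift-· π∈G πb) , lift-· π∈G πd
      related b (suc (suc zero)) Cd Ce =
        let _ , π∈G , πb , πd = non-intersecting Cd Ce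
        in lift π∈G , (lift∈ π∈G , lift-· π∈G πb) , lift-· π∈G πd

      inhabited : ∀ b i → ∃[ d ] C b i d
      inhabited b zero             = b , refl
      inhabited b (suc zero)       = let c , b≢c , int , _ = crossingBlock b in c , b≢c , int
      inhabited b (suc (suc zero)) = disjointBlock b

  2-transitive⊎rank3 : TwoTransitive (onBlocks G)
    ⊎ (TransitiveOfRank 3 (onBlocks G) × (∃[ b ] ∃[ b′ ] ¬ Intersecting b b′))
  2-transitive⊎rank3
    with finite⇒∃? blocks-finite (λ b → finite⇒∃? blocks-finite (λ b′ → ¬? (intersecting? b b′)))
  ... | yes (b , b′ , ¬int) = inj₂ (rank3 ¬int , b , b′ , ¬int)
  ... | no ∄disjoint =
    inj₁ (transitiveOnPairs-Induced G inj₂ inj₂-injective invariantᴮ {R = _≢_}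
      λ a≢b a′≢b′ → intersecting-blocks (a≢b , intersecting _ _) (a′≢b′ , intersecting _ _))
    where
    intersecting : ∀ b b′ → Intersecting b b′
    intersecting b b′ =
      decidable-stable (intersecting? b b′) λ ¬int → ∄disjoint (b , b′ , ¬int)

  pointStabiliserOrbits : ∀ p → Orbits (Stabiliser G (inj₁ p)) inj₂ HasSize 2
  pointStabiliserOrbits p = dichotomy⇒HasSize2 (Orbits (Stabiliser G (inj₁ p)) inj₂) (p I?_)
    (λ (_ , (π∈G , πp) , πb) → I⁺ π∈G πp πb)
    (λ pIb pIb′ → let π , π∈G , πp , πb = incident-pairs pIb pIb′ in π , (π∈G , πp) , πb)
    (λ ¬pIb ¬pIb′ → let π , π∈G , πp , πb = non-incident-pairs ¬pIb ¬pIb′ in π , (π∈G , πp) , πb)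
    (blockOn p) (blockOff p)

  blockStabiliserOrbits : ∀ b → Orbits (Stabiliser G (inj₂ b)) inj₁ HasSize 2
  blockStabiliserOrbits b = dichotomy⇒HasSize2 (Orbits (Stabiliser G (inj₂ b)) inj₁) (_I? b)
    (λ (_ , (π∈G , πb) , πp) → I⁺ π∈G πp πb)
    (λ pIb p′Ib → let π , π∈G , πp , πb = incident-pairs pIb p′Ib in π , (π∈G , πb) , πp)
    (λ ¬pIb ¬p′Ib → let π , π∈G , πp , πb = non-incident-pairs ¬pIb ¬p′Ib in π , (π∈G , πb) , πp)
    (pointOn b) (pointOff b)

  noRepeatedBlocks : ∀ b → ¬ Repeated b
  noRepeatedBlocks b (b′ , b′≢b , b⊆b′ , b′⊆b) =
    let p , pIb = pointOn b
        c , b≢c , int , q , qIc , ¬qIb = crossingBlock b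
        _ , π∈G , πb , πc = intersecting-blocks (b≢c , int) (≢-sym b′≢b , p , pIb , b⊆b′ pIb)
        q′ , πq = invariantᴾ π∈G q
    in ¬qIb (I⁻ π∈G πq πb (b′⊆b (I⁺ π∈G πq πc qIc)))

  pointsSeparated : ∀ p₁ p₂ → p₁ ≢ p₂ → ¬ (blocksOn p₁ ≐ blocksOn p₂)
  pointsSeparated p₁ p₂ p₁≢p₂ (p₁⊆p₂ , _) =
    let b , p₁Ib = blockOn p₁ ; q , ¬qIb = pointOff b
        _ , π∈G , πp₁ , πq = distinct-points (I∧¬I⇒≢ᴾ p₁Ib ¬qIb) p₁≢p₂
        b′ , πb = invariantᴮ π∈G b
    in ¬qIb (I⁻ π∈G πq πb (p₁⊆p₂ (I⁺ π∈G πp₁ πb p₁Ib)))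

  faithfulᴾ : FaithfulOn G inj₁
  faithfulᴾ π∈G fix (inj₁ p) = fix p
  faithfulᴾ π∈G fix (inj₂ b) with b′ , πb ← invariantᴮ π∈G b | b′ ≟ᴮ b
  ... | yes refl = πb
  ... | no b′≢b  =
    ⊥-elim (noRepeatedBlocks b (b′ , b′≢b , I⁺ π∈G (fix _) πb , I⁻ π∈G (fix _) πb))

  faithfulᴮ : FaithfulOn G inj₂
  faithfulᴮ π∈G fix (inj₂ b) = fix b
  faithfulᴮ π∈G fix (inj₁ p) with p′ , πp ← invariantᴾ π∈G p | p ≟ᴾ p′
  ... | yes refl = πp
  ... | no p≢p′  =
    ⊥-elim (pointsSeparated p p′ p≢p′ (I⁺ π∈G πp (fix _) , I⁻ π∈G πp (fix _)))

lemma2p2 : (D : Design) (let open Design D) (v k l : ℕ) →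
    Is2Design v k l → NonTrivial v k →
    (G : PermutationGroup Vertex) → G ≤ᴳ Aut → PairwiseTransitive G →
    Connected
    × TwoTransitive (onPoints G)
    × (TwoTransitive (onBlocks G)
    ⊎ (TransitiveOfRank 3 (onBlocks G) × (∃[ b ] ∃[ b′ ] ¬ Intersecting b b′)))
    × (∀ p → Orbits (Stabiliser G (inj₁ p)) inj₂ HasSize 2)
    × (∀ b → Orbits (Stabiliser G (inj₂ b)) inj₁ HasSize 2)
    × (∀ b → ¬ Repeated b)
    × (∀ p₁ p₂ → p₁ ≢ p₂ → ¬ (blocksOn p₁ ≐ blocksOn p₂))
    × FaithfulOn G inj₁
    × FaithfulOn G inj₂
lemma2p2 D v k l is2Design nonTrivial G G≤Aut pairwiseTransitive =
    connected , twoTransitiveᴾ , 2-transitive⊎rank3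
  , pointStabiliserOrbits , blockStabiliserOrbits
  , noRepeatedBlocks , pointsSeparated , faithfulᴾ , faithfulᴮ
  where
  open PairwiseTransitiveDesign D v k l is2Design nonTrivial G G≤Aut pairwiseTransitive
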